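{- Let $\Sigma=(\mathsf{P}_\Sigma,\mathsf{R}_\Sigma,\rho^\Sigma)$ be a PR-structure. Then $\Sigma$ is posetal if and only if it is preorderal and the relation $\vdash^\Sigma$ on $\mathsf{P}_\Sigma$ is antisymmetric.
   Context: A PR-structure is a triple $\Sigma=(\mathsf{P}_\Sigma,\mathsf{R}_\Sigma,\rho^\Sigma)$ where $\mathsf{P}_\Sigma$ and $\mathsf{R}_\Sigma$ are non-empty sets and $\rho^\Sigma:\mathsf{P}_\Sigma\times\mathsf{P}_\Sigma\to\mathcal{P}(\mathsf{R}_\Sigma)$ is a function. For a set $I$ and functions $\varphi,\psi:I\to\mathsf{P}_\Sigma$, write $\varphi\vdash^\Sigma_I\psi$ iff $\bigcap_{i\in I}\rho^\Sigma(\varphi(i),\psi(i))\neq\emptyset$, i.e. iff there is $r\in\mathsf{R}_\Sigma$ with $r\in\rho^\Sigma(\varphi(i),\psi(i))$ for every $i\in I$. For $a,b\in\mathsf{P}_\Sigma$, write $a\vdash^\Sigma b$ iff $\rho^\Sigma(a,b)\neq\emptyset$. $\Sigma$ is preorderal (resp. posetal) if for every set $I$ the relation $\vdash^\Sigma_I$ on $\mathsf{P}_\Sigma^I$ is a preorder (resp. a partial order). -}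

module Defs where

open import Level using (Level; _⊔_; suc)
open import Relation.Binary.Core using (Rel)
open import Relation.Binary.PropositionalEquality using (_≗_)
open import Relation.Binary.Structures using (IsPreorder; IsPartialOrder)
open import Relation.Unary using (Pred; Satisfiable; ⋂)

private
  variable
    p r ℓ : Level

-- Non-emptiness is expressed by an inhabitant; subsets of R are predicates.
record PRStructure (p r ℓ : Level) : Set (suc (p ⊔ r ⊔ ℓ)) where
  field
    P          : Set p
    R          : Set r
    P-nonempty : P
    R-nonempty : R
    ρ          : P → P → Pred R ℓ

module _ (S : PRStructure p r ℓ) where
  open PRStructure S

  Entails : P → P → Set (r ⊔ ℓ)
  Entails a b = Satisfiable (ρ a b)

  EntailsOn : ∀ {i} (I : Set i) → Rel (I → P) (r ⊔ ℓ ⊔ i)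
  EntailsOn I φ ψ = Satisfiable (⋂ I λ i → ρ (φ i) (ψ i))

  -- Elements of the function set P^I are equal when they agree pointwise, so
  -- the orders are taken relative to _≗_.  "Every set I" ranges over an
  -- arbitrary universe level i.
  Preorderal : ∀ i → Set (p ⊔ r ⊔ ℓ ⊔ suc i)
  Preorderal i = (I : Set i) → IsPreorder (_≗_ {A = I} {B = P}) (EntailsOn I)

  Posetal : ∀ i → Set (p ⊔ r ⊔ ℓ ⊔ suc i)
  Posetal i = (I : Set i) → IsPartialOrder (_≗_ {A = I} {B = P}) (EntailsOn I)

{-# OPTIONS --safe #-}
module Submission where

open import Data.Product using (_×_; _,_; map₂)
open import Data.Unit.Polymorphic using (⊤; tt)
open import Function.Base using (const)
open import Function.Bundles using (_⇔_; mk⇔)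
open import Level using (Level)
open import Relation.Binary.Definitions using (Antisymmetric)
open import Relation.Binary.PropositionalEquality using (_≡_; _≗_)
open import Relation.Binary.Structures using (IsPartialOrder)
open import Defs

-- Both sides contain the preorder axioms, so only antisymmetry is at stake. Over a one-point index
-- set `EntailsOn` amounts to `Entails`, so antisymmetry there descends to `P`. Conversely, a
-- uniform witness for two families is a witness at each index and families are equal when they
-- agree pointwise, so antisymmetry on `P` lifts to every `I` (`entailsOn-antisym`).

module _ {p r ℓ i : Level} (S : PRStructure p r ℓ) where
  open PRStructure S

  -- One witness serves every index, since both families are constant.
  entails-const : ∀ {I : Set i} {a b} →
    Entails S a b → EntailsOn S I (const a) (const b)
  entails-const = map₂ const

  entails-at : ∀ {I : Set i} {φ ψ : I → P} (x : I) →
    EntailsOn S I φ ψ → Entails S (φ x) (ψ x)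
  entails-at x = map₂ λ common → common x

  posetal⇒entails-antisym : Posetal S i → Antisymmetric _≡_ (Entails S)
  posetal⇒entails-antisym posetal a⊢b b⊢a =
    -- The polymorphic `⊤` is a one-point set at level `i`; evaluating the pointwise equality of the
    -- constant families at `tt` recovers equality in `P`.
    IsPartialOrder.antisym (posetal ⊤) (entails-const a⊢b) (entails-const b⊢a) tt

  posetal⇒preorderal∧antisym :
    Posetal S i → Preorderal S i × Antisymmetric _≡_ (Entails S)
  posetal⇒preorderal∧antisym posetal =
    (λ I → IsPartialOrder.isPreorder (posetal I)) , λ {_} {_} → posetal⇒entails-antisym posetal

  entailsOn-antisym : Antisymmetric _≡_ (Entails S) →
    (I : Set i) → Antisymmetric (_≗_ {A = I} {B = P}) (EntailsOn S I)
  entailsOn-antisym antisym I φ⊢ψ ψ⊢φ x =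
    -- The two directions may have different witnesses; each is uniform, so both apply at `x`.
    antisym (entails-at x φ⊢ψ) (entails-at x ψ⊢φ)

  preorderal∧antisym⇒posetal :
    Preorderal S i × Antisymmetric _≡_ (Entails S) → Posetal S i
  preorderal∧antisym⇒posetal (preorderal , entails-antisym) I = record
    { isPreorder = preorderal I
    ; antisym    = entailsOn-antisym entails-antisym I
    }

theorem2p21 : ∀ {p r ℓ} i (S : PRStructure p r ℓ) →
    Posetal S i ⇔ (Preorderal S i × Antisymmetric _≡_ (Entails S))
theorem2p21 i S = mk⇔ (posetal⇒preorderal∧antisym S) (preorderal∧antisym⇒posetal S)
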